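{- Let $n\ge 0$. On triangulations of the convex $(n+2)$-gon with vertices labeled $1,\dots,n+2$, the map $h$ acts by relabeling each vertex $i$ as $n+3-i$. Equivalently, $h(T)$ is the triangulation whose edges are $(n+3-i,\,n+3-j)$ for $(i,j)$ an edge of $T$.
   Context: A Catalan structure is a quadruple $(C,e,\lambda,\oplus)$ where $C=\bigsqcup_{n\ge 0}C_n$ with $C_0=\{e\}$ ($|t|=n$ for $t\in C_n$), $\lambda\colon C_n\to C_{n+1}$, $\oplus\colon C_m\times C_n\to C_{m+n}$, $\oplus$ is associative with two-sided identity $e$, and every $t\in C$ can be written uniquely in exactly one of three forms: $t=e$; $t=\lambda(s)$ (indecomposable); $t=u\oplus v$ with $u$ indecomposable and $v\neq e$ (decomposable). Every nonempty $t$ is then uniquely $\lambda(u)\oplus v$ ($v=e$ allowed). Put $\gamma(t)=t\oplus\lambda(e)$ and define $\ominus$ by $e\ominus v=v$, $\lambda(u)\ominus v=\lambda(u\ominus v)$, $(t\oplus u)\ominus v=t\oplus(u\ominus v)$ for $t,u\ne e$. The map $h$ is defined by $h(e)=e$, $h(\lambda(u)\oplus v)=h(v)\ominus\gamma(h(u))$. Triangulations form a Catalan structure as follows. A triangulation of size $n$ is a maximal set of non-crossing diagonals of the convex $(n+2)$-gon with vertices labeled $1,\dots,n+2$ clockwise (its edges are these diagonals together with the boundary edges); for $n=0$ it is the single edge $(1,2)$, which is $e$. $\lambda(T)$ for $T$ of size $n$: relabel each vertex $i\mapsto i+1$ and add a new vertex $1$ adjacent to $2$ and to $n+3$. $T_1\oplus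 T_2$ with $|T_1|=n_1$: identify the edge $(1,n_1+2)$ of $T_1$ with the edge $(1,2)$ of $T_2$, keeping the labels of $T_1$, with vertex $1$ of $T_2$ becoming $1$ and vertex $j\ge 2$ of $T_2$ becoming $n_1+j$. -}

module Defs where

open import Algebra.Structures using (IsMonoid)
open import Data.Empty using (⊥; ⊥-elim)
open import Data.Nat using (ℕ; zero; suc; _+_; _∸_; _≤_; _<_; z≤n; s≤s; _≟_; _≤?_; _<?_)
open import Data.Nat.Induction using (<-wellFounded)
open import Data.Nat.Properties
open import Data.Product using (Σ; ∃; ∃₂; _×_; _,_; proj₁; proj₂)
open import Data.Sum using (_⊎_; inj₁; inj₂)
open import Function.Bundles using (_⇔_; mk⇔; Equivalence)
open import Induction.WellFounded using (Acc; acc)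
open import Level using (Level; 0ℓ) renaming (suc to lsuc; _⊔_ to _⊔ˡ_)
open import Relation.Binary.Bundles using (Setoid)
open import Relation.Binary.Construct.Closure.Symmetric using (SymClosure; fwd; bwd)
open import Relation.Binary.Core using (Rel; _⇒_)
open import Relation.Binary.Definitions using (Decidable; tri<; tri≈; tri>)
open import Relation.Binary.PropositionalEquality
  using (_≡_; refl; sym; trans; cong; cong₂; subst; subst₂)
import Relation.Binary.Reasoning.Setoid as SetoidReasoning
open import Relation.Nullary using (¬_; Dec; yes; no)
open import Relation.Nullary.Decidable using (_×-dec_; _⊎-dec_; ¬?) renaming (map′ to mapDec)

-- The grading C = ⨆ₙ Cₙ is given by a size function on the total space,
-- Cₙ being the fibre over n; equality is a setoid equality.

record CatalanStructure (c ℓ : Level) : Set (lsuc (c ⊔ˡ ℓ)) where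
  infix  4 _≈_
  infixr 6 _⊕_
  field
    Carrier : Set c
    _≈_     : Rel Carrier ℓ
    size    : Carrier → ℕ
    e       : Carrier
    lam     : Carrier → Carrier
    _⊕_     : Carrier → Carrier → Carrier

  Indecomposable : Carrier → Set (c ⊔ˡ ℓ)
  Indecomposable t = ∃ λ s → t ≈ lam s

  Decomposition : Carrier → Carrier → Carrier → Set (c ⊔ˡ ℓ)
  Decomposition t u v = Indecomposable u × ¬ (v ≈ e) × t ≈ u ⊕ v

  field
    ⊕-isMonoid : IsMonoid _≈_ _⊕_ e
    lam-cong   : ∀ {s t} → s ≈ t → lam s ≈ lam t
    size-cong  : ∀ {s t} → s ≈ t → size s ≡ size t

    size-e     : size e ≡ 0
    size-zero  : ∀ t → size t ≡ 0 → t ≈ e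
    size-lam   : ∀ t → size (lam t) ≡ suc (size t)
    size-⊕     : ∀ s t → size (s ⊕ t) ≡ size s + size t

    cover      : ∀ t → t ≈ e ⊎ Indecomposable t ⊎ ∃₂ (Decomposition t)

    e-indec    : ∀ {t} → t ≈ e → ¬ Indecomposable t
    e-decomp   : ∀ {t u v} → t ≈ e → ¬ Decomposition t u v
    indec-decomp : ∀ {t u v} → Indecomposable t → ¬ Decomposition t u v

    lam-unique : ∀ {s s′} → lam s ≈ lam s′ → s ≈ s′
    ⊕-unique   : ∀ {t u v u′ v′} → Decomposition t u v → Decomposition t u′ v′ →
                 u ≈ u′ × v ≈ v′

module Operations {c ℓ} (C : CatalanStructure c ℓ) where
  open CatalanStructure C
  open IsMonoid ⊕-isMonoid using (isEquivalence; assoc; identityˡ; identityʳ)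
    renaming (∙-cong to ⊕-cong; refl to ≈-refl; sym to ≈-sym; trans to ≈-trans)

  ≈-setoid : Setoid c ℓ
  ≈-setoid = record { isEquivalence = isEquivalence }

  -- A chosen iterated decomposition t = lam u ⊕ v (v = e allowed).
  data Form (t : Carrier) : Set (c ⊔ˡ ℓ) where
    empty : t ≈ e → Form t
    node  : ∀ {u v} → Form u → Form v → t ≈ lam u ⊕ v → Form t

  size-node : ∀ {t u v} → t ≈ lam u ⊕ v → size t ≡ suc (size u + size v)
  size-node {t} {u} {v} eq =
    trans (size-cong eq) (trans (size-⊕ (lam u) v) (cong (_+ size v) (size-lam u)))

  node≉e : ∀ {t u v} → t ≈ lam u ⊕ v → ¬ (t ≈ e)
  node≉e eq t≈e with trans (sym (size-node eq)) (trans (size-cong t≈e) size-e)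
  ... | ()

  form-acc : ∀ t → Acc _<_ (size t) → Form t
  form-acc t (acc rs) with cover t
  ... | inj₁ t≈e = empty t≈e
  ... | inj₂ (inj₁ (s , t≈)) =
    node (form-acc s (rs (≤-reflexive (sym (trans (size-cong t≈) (size-lam s))))))
         (empty ≈-refl) (≈-trans t≈ (≈-sym (identityʳ _)))
  ... | inj₂ (inj₂ (u , v , (s , u≈) , _ , t≈)) =
    node (form-acc s (rs (subst (size s <_) (sym st) (s≤s (m≤m+n _ _)))))
         (form-acc v (rs (subst (size v <_) (sym st) (s≤s (m≤n+m _ _)))))
         eq
    where
    eq : t ≈ lam s ⊕ v
    eq = ≈-trans t≈ (⊕-cong u≈ ≈-refl)
    st : size t ≡ suc (size s + size v)
    st = size-node eq

  form : ∀ t → Form t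
  form t = form-acc t (<-wellFounded (size t))

  γ : Carrier → Carrier
  γ t = t ⊕ lam e

  minus : ∀ {t} → Form t → Carrier → Carrier
  minus (empty _)                  v = v
  minus (node p (empty _) _)       v = lam (minus p v)
  minus (node {u} p q@(node _ _ _) _) v = lam u ⊕ minus q v

  infixr 6 _⊖_
  _⊖_ : Carrier → Carrier → Carrier
  t ⊖ v = minus (form t) v

  h′ : ∀ {t} → Form t → Carrier
  h′ (empty _)    = e
  h′ (node p q _) = h′ q ⊖ γ (h′ p)

  h : Carrier → Carrier
  h t = h′ (form t)

  -- ⊖ and h satisfy, and are hence determined by, their defining equations.

  e? : ∀ t → Dec (t ≈ e)
  e? t with size t ≟ 0
  ... | yes p = yes (size-zero t p)
  ... | no ¬p = no λ t≈e → ¬p (trans (size-cong t≈e) size-e)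

  indec : ∀ u → Indecomposable (lam u)
  indec u = u , ≈-refl

  node-unique : ∀ {u v u′ v′} → lam u ⊕ v ≈ lam u′ ⊕ v′ → u ≈ u′ × v ≈ v′
  node-unique {u} {v} {u′} {v′} eq with e? v | e? v′
  ... | yes p | yes q =
    lam-unique (begin
      lam u        ≈⟨ identityʳ _ ⟨
      lam u ⊕ e    ≈⟨ ⊕-cong ≈-refl p ⟨
      lam u ⊕ v    ≈⟨ eq ⟩
      lam u′ ⊕ v′  ≈⟨ ⊕-cong ≈-refl q ⟩
      lam u′ ⊕ e   ≈⟨ identityʳ _ ⟩
      lam u′       ∎) , ≈-trans p (≈-sym q)
    where open SetoidReasoning ≈-setoid
  ... | yes p | no ¬q = ⊥-elim (indec-decomp
      (u , ≈-trans (⊕-cong ≈-refl p) (identityʳ _)) (indec u′ , ¬q , eq))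
  ... | no ¬p | yes q = ⊥-elim (indec-decomp
      (u′ , ≈-trans (⊕-cong ≈-refl q) (identityʳ _)) (indec u , ¬p , ≈-sym eq))
  ... | no ¬p | no ¬q with ⊕-unique (indec u , ¬p , ≈-refl) (indec u′ , ¬q , eq)
  ...   | lu , vv = lam-unique lu , vv

  minus-cong : ∀ {t t′ v v′} (p : Form t) (p′ : Form t′) → t ≈ t′ → v ≈ v′ →
               minus p v ≈ minus p′ v′
  minus-cong (empty _) (empty _) _ vv = vv
  minus-cong (empty x) (node _ _ y) tt _ = ⊥-elim (node≉e (≈-trans tt y) x)
  minus-cong (node _ _ y) (empty x) tt _ = ⊥-elim (node≉e (≈-trans (≈-sym tt) y) x)
  minus-cong (node p q x) (node p′ q′ x′) tt vv
    with node-unique (≈-trans (≈-sym x) (≈-trans tt x′))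
  minus-cong (node p (empty _) _) (node p′ (empty _) _) _ vv | uu , _ =
    lam-cong (minus-cong p p′ uu vv)
  minus-cong (node p (empty a) _) (node p′ (node _ _ b) _) _ _ | _ , ww =
    ⊥-elim (node≉e (≈-trans ww b) a)
  minus-cong (node p (node _ _ b) _) (node p′ (empty a) _) _ _ | _ , ww =
    ⊥-elim (node≉e (≈-trans (≈-sym ww) b) a)
  minus-cong (node p q@(node _ _ _) _) (node p′ q′@(node _ _ _) _) _ vv | uu , ww =
    ⊕-cong (lam-cong uu) (minus-cong q q′ ww vv)

  ⊖-cong : ∀ {t t′ v v′} → t ≈ t′ → v ≈ v′ → t ⊖ v ≈ t′ ⊖ v′
  ⊖-cong {t} {t′} = minus-cong (form t) (form t′)

  ⊖-e : ∀ v → e ⊖ v ≈ v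
  ⊖-e v = minus-cong (form e) (empty ≈-refl) ≈-refl ≈-refl

  ⊖-lam : ∀ u v → lam u ⊖ v ≈ lam (u ⊖ v)
  ⊖-lam u v = minus-cong (form (lam u))
    (node (form u) (empty ≈-refl) (≈-sym (identityʳ _))) ≈-refl ≈-refl

  ⊕≉e : ∀ {b u} → ¬ (u ≈ e) → ¬ (b ⊕ u ≈ e)
  ⊕≉e {b} {u} ¬u eq = ¬u (size-zero u (m+n≡0⇒n≡0 (size b)
    (trans (sym (size-⊕ b u)) (trans (size-cong eq) size-e))))

  ⊖-node : ∀ a {b t} v → ¬ (b ≈ e) → t ≈ lam a ⊕ b → t ⊖ v ≈ lam a ⊕ (b ⊖ v)
  ⊖-node a {b} {t} v ¬b eq with form b
  ... | empty x = ⊥-elim (¬b x)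
  ... | q@(node _ _ _) = minus-cong (form t) (node (form a) q eq) ≈-refl ≈-refl

  ⊖-⊕-form : ∀ {t} → Form t → ∀ {u} v → ¬ (t ≈ e) → ¬ (u ≈ e) →
             (t ⊕ u) ⊖ v ≈ t ⊕ (u ⊖ v)
  ⊖-⊕-form (empty x) v ¬t _ = ⊥-elim (¬t x)
  ⊖-⊕-form {t} (node {a} {b} _ q x) {u} v ¬t ¬u with e? b
  ... | yes b≈e = begin
    (t ⊕ u) ⊖ v        ≈⟨ ⊖-node a v ¬u (⊕-cong t≈ ≈-refl) ⟩
    lam a ⊕ (u ⊖ v)    ≈⟨ ⊕-cong t≈ ≈-refl ⟨
    t ⊕ (u ⊖ v)        ∎
    where
    open SetoidReasoning ≈-setoid
    t≈ : t ≈ lam a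
    t≈ = ≈-trans x (≈-trans (⊕-cong ≈-refl b≈e) (identityʳ _))
  ... | no ¬b = begin
    (t ⊕ u) ⊖ v              ≈⟨ ⊖-node a v (⊕≉e ¬u) (≈-trans (⊕-cong x ≈-refl) (assoc _ _ _)) ⟩
    lam a ⊕ ((b ⊕ u) ⊖ v)    ≈⟨ ⊕-cong ≈-refl (⊖-⊕-form q v ¬b ¬u) ⟩
    lam a ⊕ (b ⊕ (u ⊖ v))    ≈⟨ assoc _ _ _ ⟨
    (lam a ⊕ b) ⊕ (u ⊖ v)    ≈⟨ ⊕-cong x ≈-refl ⟨
    t ⊕ (u ⊖ v)              ∎
    where open SetoidReasoning ≈-setoid

  ⊖-⊕ : ∀ t u v → ¬ (t ≈ e) → ¬ (u ≈ e) → (t ⊕ u) ⊖ v ≈ t ⊕ (u ⊖ v)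
  ⊖-⊕ t u v = ⊖-⊕-form (form t) v

  h′-cong : ∀ {t t′} (p : Form t) (p′ : Form t′) → t ≈ t′ → h′ p ≈ h′ p′
  h′-cong (empty _) (empty _) _ = ≈-refl
  h′-cong (empty x) (node _ _ y) tt = ⊥-elim (node≉e (≈-trans tt y) x)
  h′-cong (node _ _ y) (empty x) tt = ⊥-elim (node≉e (≈-trans (≈-sym tt) y) x)
  h′-cong (node p q x) (node p′ q′ x′) tt
    with node-unique (≈-trans (≈-sym x) (≈-trans tt x′))
  ... | uu , ww = ⊖-cong (h′-cong q q′ ww) (⊕-cong (h′-cong p p′ uu) ≈-refl)

  h-cong : ∀ {t t′} → t ≈ t′ → h t ≈ h t′
  h-cong {t} {t′} = h′-cong (form t) (form t′)

  h-e : h e ≈ e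
  h-e = h′-cong (form e) (empty ≈-refl) ≈-refl

  h-node : ∀ u v → h (lam u ⊕ v) ≈ h v ⊖ γ (h u)
  h-node u v = h′-cong (form (lam u ⊕ v)) (node (form u) (form v) ≈-refl) ≈-refl

-- Triangulations of the convex (n+2)-gon with vertices 1, …, n+2
--
-- An unordered pair of vertices {i , j} is written (i , j) with i < j.

Chord : ℕ → Rel ℕ 0ℓ
Chord n i j = 1 ≤ i × i < j × j ≤ 2 + n

Side : ℕ → Rel ℕ 0ℓ
Side n i j = j ≡ suc i ⊎ (i ≡ 1 × j ≡ 2 + n)

Diagonal : ℕ → Rel ℕ 0ℓ
Diagonal n i j = Chord n i j × ¬ Side n i j

Crosses : ℕ → ℕ → ℕ → ℕ → Set
Crosses i j k l = (i < k × k < j × j < l) ⊎ (k < i × i < l × l < j)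

NonCrossingDiagonals : ℕ → Rel ℕ 0ℓ → Set
NonCrossingDiagonals n S =
  (∀ {i j} → S i j → Diagonal n i j) ×
  (∀ {i j k l} → S i j → S k l → ¬ Crosses i j k l)

-- Every set of diagonals is a subset of a finite set, so membership is
-- decidable.
record Triangulation (n : ℕ) : Set₁ where
  field
    Diag        : Rel ℕ 0ℓ
    Diag?       : Decidable Diag
    noncrossing : NonCrossingDiagonals n Diag
    maximal     : ∀ (S : Rel ℕ 0ℓ) → NonCrossingDiagonals n S → Diag ⇒ S → S ⇒ Diag

open Triangulation public using (Diag)

Edge↑ : ∀ {n} → Triangulation n → Rel ℕ 0ℓ
Edge↑ {n} T i j = Chord n i j × (Side n i j ⊎ Diag T i j)

-- Unlike Edge↑, Edge T i j allows the endpoints in either order.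
Edge : ∀ {n} → Triangulation n → Rel ℕ 0ℓ
Edge T = SymClosure (Edge↑ T)

side? : ∀ n → Decidable (Side n)
side? n i j = (j ≟ suc i) ⊎-dec ((i ≟ 1) ×-dec (j ≟ 2 + n))

chord? : ∀ n → Decidable (Chord n)
chord? n i j = (1 ≤? i) ×-dec ((i <? j) ×-dec (j ≤? 2 + n))

edge↑? : ∀ {n} (T : Triangulation n) → Decidable (Edge↑ T)
edge↑? {n} T i j = chord? n i j ×-dec (side? n i j ⊎-dec Triangulation.Diag? T i j)

crosses-sym : ∀ {i j k l} → Crosses i j k l → Crosses k l i j
crosses-sym (inj₁ x) = inj₂ x
crosses-sym (inj₂ x) = inj₁ x

side-¬crosses : ∀ {n i j k l} → Side n i j → Chord n k l → ¬ Crosses i j k l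
side-¬crosses (inj₁ refl) _ (inj₁ (i<k , s≤s k≤i , _)) = <⇒≱ i<k k≤i
side-¬crosses (inj₁ refl) _ (inj₂ (_ , i<l , s≤s l≤i)) = <⇒≱ i<l l≤i
side-¬crosses (inj₂ (refl , refl)) (_ , _ , l≤) (inj₁ (_ , _ , <l)) = <⇒≱ <l l≤
side-¬crosses (inj₂ (refl , refl)) (1≤k , _ , _) (inj₂ (k<1 , _ , _)) = <⇒≱ k<1 1≤k

-- A triangulation may equally be given by its edges: a set of pairwise
-- non-crossing chords to which no chord can be added.
record EdgeSet (n : ℕ) (E : Rel ℕ 0ℓ) : Set where
  field
    E?          : Decidable E
    chord       : ∀ {i j} → E i j → Chord n i j
    noncrossing : ∀ {i j k l} → E i j → E k l → ¬ Crosses i j k l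
    saturated   : ∀ {i j} → Chord n i j → (∀ {k l} → E k l → ¬ Crosses i j k l) → E i j

  side⇒E : ∀ {i j} → Chord n i j → Side n i j → E i j
  side⇒E ch s = saturated ch λ ekl → side-¬crosses s (chord ekl)

fromEdges : ∀ {n} {E : Rel ℕ 0ℓ} → EdgeSet n E → Triangulation n
fromEdges {n} {E} es = record
  { Diag        = λ i j → E i j × ¬ Side n i j
  ; Diag?       = λ i j → E? i j ×-dec ¬? (side? n i j)
  ; noncrossing = (λ { (eij , ¬s) → chord eij , ¬s })
                , λ { (eij , _) (ekl , _) → noncrossing eij ekl }
  ; maximal     = λ { S (diag , nc) D⊆S {i} {j} sij →
      saturated (proj₁ (diag sij)) (λ {k} {l} ekl → crossing S diag nc D⊆S sij ekl)
      , proj₂ (diag sij) }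
  }
  where
  open EdgeSet es
  crossing : (S : Rel ℕ 0ℓ) → (∀ {i j} → S i j → Diagonal n i j) →
             (∀ {i j k l} → S i j → S k l → ¬ Crosses i j k l) →
             (λ i j → E i j × ¬ Side n i j) ⇒ S →
             ∀ {i j k l} → S i j → E k l → ¬ Crosses i j k l
  crossing S diag nc D⊆S {k = k} {l} sij ekl cr with side? n k l
  ... | yes s = side-¬crosses s (proj₁ (diag sij)) (crosses-sym cr)
  ... | no ¬s = nc sij (D⊆S (ekl , ¬s)) cr

fromEdges-edge : ∀ {n} {E : Rel ℕ 0ℓ} (es : EdgeSet n E) {i j} →
                 Edge↑ (fromEdges es) i j ⇔ E i j
fromEdges-edge {n} {E} es {i} {j} = mk⇔ to from
  where
  open EdgeSet es
  to : Edge↑ (fromEdges es) i j → E i j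
  to (ch , inj₁ s)       = side⇒E ch s
  to (ch , inj₂ (x , _)) = x
  from : E i j → Edge↑ (fromEdges es) i j
  from x with side? n i j
  ... | yes s = chord x , inj₁ s
  ... | no ¬s = chord x , inj₂ (x , ¬s)

edges : ∀ {n} (T : Triangulation n) → EdgeSet n (Edge↑ T)
edges {n} T = record
  { E?          = edge↑? T
  ; chord       = proj₁
  ; noncrossing = nc
  ; saturated   = sat
  }
  where
  open Triangulation T using (maximal) renaming (noncrossing to ncD)
  nc : ∀ {i j k l} → Edge↑ T i j → Edge↑ T k l → ¬ Crosses i j k l
  nc (_ , inj₁ s) (c′ , _) cr = side-¬crosses s c′ cr
  nc (c , inj₂ _) (_ , inj₁ s) cr = side-¬crosses s c (crosses-sym cr)
  nc (_ , inj₂ d) (_ , inj₂ d′) cr = proj₂ ncD d d′ cr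
  sat : ∀ {i j} → Chord n i j → (∀ {k l} → Edge↑ T k l → ¬ Crosses i j k l) → Edge↑ T i j
  sat {i} {j} ch ¬cr with side? n i j
  ... | yes s = ch , inj₁ s
  ... | no ¬s = ch , inj₂ (maximal S (diag , ncS) inj₁ (inj₂ (refl , refl)))
    where
    S : Rel ℕ 0ℓ
    S a b = Diag T a b ⊎ (a ≡ i × b ≡ j)
    diag : ∀ {a b} → S a b → Diagonal n a b
    diag (inj₁ d) = proj₁ ncD d
    diag (inj₂ (refl , refl)) = ch , ¬s
    edge : ∀ {a b} → Diag T a b → Edge↑ T a b
    edge d = proj₁ (proj₁ ncD d) , inj₂ d
    ncS : ∀ {a b c d} → S a b → S c d → ¬ Crosses a b c d
    ncS (inj₁ x) (inj₁ y) cr = proj₂ ncD x y cr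
    ncS (inj₁ x) (inj₂ (refl , refl)) cr = ¬cr (edge x) (crosses-sym cr)
    ncS (inj₂ (refl , refl)) (inj₁ y) cr = ¬cr (edge y) cr
    ncS (inj₂ (refl , refl)) (inj₂ (refl , refl)) (inj₁ (p , _)) = <-irrefl refl p
    ncS (inj₂ (refl , refl)) (inj₂ (refl , refl)) (inj₂ (p , _)) = <-irrefl refl p

module Ed {n} (T : Triangulation n) = EdgeSet (edges T)

module _ where
  private
    E : Rel ℕ 0ℓ
    E a b = a ≡ 1 × b ≡ 2

  ⟨e⟩-edges : EdgeSet 0 E
  ⟨e⟩-edges = record
    { E?          = λ a b → (a ≟ 1) ×-dec (b ≟ 2)
    ; chord       = λ { (refl , refl) → s≤s z≤n , ≤-refl , ≤-refl }
    ; noncrossing = λ { (refl , refl) (refl , refl) (inj₁ (p , _)) → <-irrefl refl p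
                      ; (refl , refl) (refl , refl) (inj₂ (p , _)) → <-irrefl refl p }
    ; saturated   = λ { (1≤i , i<j , j≤2) _ → sat 1≤i i<j j≤2 }
    }
    where
    sat : ∀ {i j} → 1 ≤ i → i < j → j ≤ 2 → i ≡ 1 × j ≡ 2
    sat {i} 1≤i i<j j≤2 = ≤-antisym (≤-pred (≤-trans i<j j≤2)) 1≤i
                        , ≤-antisym j≤2 (≤-trans (s≤s 1≤i) i<j)

⟨e⟩ : Triangulation 0
⟨e⟩ = fromEdges ⟨e⟩-edges

LamEdge : ∀ {n} → Triangulation n → Rel ℕ 0ℓ
LamEdge {n} T a b = (a ≡ 1 × (b ≡ 2 ⊎ b ≡ n + 3))
                  ⊎ ∃₂ λ i j → Edge↑ T i j × a ≡ suc i × b ≡ suc j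

shift-crosses : ∀ {i j k l} → Crosses (suc i) (suc j) (suc k) (suc l) → Crosses i j k l
shift-crosses (inj₁ (s≤s p , s≤s q , s≤s r)) = inj₁ (p , q , r)
shift-crosses (inj₂ (s≤s p , s≤s q , s≤s r)) = inj₂ (p , q , r)

unshift-crosses : ∀ {i j k l} → Crosses i j k l → Crosses (suc i) (suc j) (suc k) (suc l)
unshift-crosses (inj₁ (p , q , r)) = inj₁ (s≤s p , s≤s q , s≤s r)
unshift-crosses (inj₂ (p , q , r)) = inj₂ (s≤s p , s≤s q , s≤s r)

full : ∀ {n} (T : Triangulation n) → Edge↑ T 1 (2 + n)
full T = (s≤s z≤n , s≤s (s≤s z≤n) , ≤-refl) , inj₁ (inj₂ (refl , refl))

lam-edges : ∀ {n} (T : Triangulation n) → EdgeSet (suc n) (LamEdge T)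
lam-edges {n} T = record { E? = dec ; chord = ch ; noncrossing = nc ; saturated = sat }
  where
  n+3 : n + 3 ≡ 3 + n
  n+3 = +-comm n 3
  dec : Decidable (LamEdge T)
  dec a b = ((a ≟ 1) ×-dec ((b ≟ 2) ⊎-dec (b ≟ n + 3))) ⊎-dec shifted a b
    where
    shifted : Decidable λ a b → ∃₂ λ i j → Edge↑ T i j × a ≡ suc i × b ≡ suc j
    shifted zero b = no λ { (_ , _ , _ , () , _) }
    shifted (suc a) zero = no λ { (_ , _ , _ , _ , ()) }
    shifted (suc i) (suc j) = mapDec (λ x → i , j , x , refl , refl)
      (λ { (_ , _ , x , refl , refl) → x }) (edge↑? T i j)
  ch : ∀ {a b} → LamEdge T a b → Chord (suc n) a b
  ch (inj₁ (refl , inj₁ refl)) = s≤s z≤n , ≤-refl , s≤s (s≤s z≤n)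
  ch (inj₁ (refl , inj₂ refl)) rewrite n+3 = s≤s z≤n , s≤s (s≤s z≤n) , ≤-refl
  ch (inj₂ (i , j , ((_ , i<j , j≤) , _) , refl , refl)) = s≤s z≤n , s≤s i<j , s≤s j≤
  sd : ∀ {a b} → a ≡ 1 × (b ≡ 2 ⊎ b ≡ n + 3) → Side (suc n) a b
  sd (refl , inj₁ refl) = inj₁ refl
  sd (refl , inj₂ refl) = inj₂ (refl , n+3)
  nc : ∀ {a b c d} → LamEdge T a b → LamEdge T c d → ¬ Crosses a b c d
  nc (inj₁ x) y cr = side-¬crosses (sd x) (ch y) cr
  nc x@(inj₂ _) (inj₁ y) cr = side-¬crosses (sd y) (ch x) (crosses-sym cr)
  nc (inj₂ (_ , _ , x , refl , refl)) (inj₂ (_ , _ , y , refl , refl)) cr =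
    Ed.noncrossing T x y (shift-crosses cr)
  sat : ∀ {a b} → Chord (suc n) a b → (∀ {c d} → LamEdge T c d → ¬ Crosses a b c d) →
        LamEdge T a b
  sat {suc zero} {b} (_ , 1<b , b≤) ¬cr with b ≟ 2 | b ≟ n + 3
  ... | yes p | _ = inj₁ (refl , inj₁ p)
  ... | no _ | yes q = inj₁ (refl , inj₂ q)
  ... | no p | no q = ⊥-elim (¬cr (inj₂ (1 , 2 + n , full T , refl , refl))
    (inj₁ (≤-refl , ≤∧≢⇒< 1<b (λ z → p (sym z)) , ≤∧≢⇒< b≤ (λ z → q (trans z (sym n+3))))))
  sat {suc (suc i)} {suc j} (_ , s≤s i<j , s≤s j≤) ¬cr =
    inj₂ (suc i , j , Ed.saturated T (s≤s z≤n , i<j , j≤)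
      (λ {k} {l} x cr → ¬cr (inj₂ (k , l , x , refl , refl)) (unshift-crosses cr))
      , refl , refl)

⟨lam⟩ : ∀ {n} → Triangulation n → Triangulation (suc n)
⟨lam⟩ T = fromEdges (lam-edges T)

-- Relabelling of the second summand of ⊕; 0 is not a vertex.
glue : ℕ → ℕ → ℕ
glue n₁ 1 = 1
glue n₁ j = n₁ + j

PlusEdge : ∀ {n₁ n₂} → Triangulation n₁ → Triangulation n₂ → Rel ℕ 0ℓ
PlusEdge {n₁} T₁ T₂ a b = Edge↑ T₁ a b
                        ⊎ ∃₂ λ i j → Edge↑ T₂ i j × a ≡ glue n₁ i × b ≡ glue n₁ j

glue-≥2 : ∀ m {i} → 2 ≤ i → glue m i ≡ m + i
glue-≥2 m {suc (suc i)} _ = refl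
glue-≥2 m {suc zero} (s≤s ())

-- For 1 ≤ i, either i = 1 and is fixed or i ≥ 2.
data View (m : ℕ) : ℕ → ℕ → Set where
  one  : View m 1 1
  more : ∀ {i} → 2 ≤ i → View m i (m + i)

view : ∀ m {i} → 1 ≤ i → View m i (glue m i)
view m {suc zero} _ = one
view m {suc (suc i)} _ = more (s≤s (s≤s z≤n))

glue-mono : ∀ m {i k} → 1 ≤ i → i < k → glue m i < glue m k
glue-mono m {i} {k} 1≤i i<k with glue m i | view m 1≤i | glue m k | view m (≤-trans 1≤i (<⇒≤ i<k))
... | _ | one | _ | one = i<k
... | _ | one | _ | more 2≤k = ≤-trans 2≤k (m≤n+m k m)
... | _ | more 2≤i | _ | one = ⊥-elim (<⇒≱ i<k (≤-trans (s≤s z≤n) 2≤i))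
... | _ | more _ | _ | more _ = +-monoʳ-< m i<k

glue-reflect : ∀ m {i k} → 1 ≤ i → 1 ≤ k → glue m i < glue m k → i < k
glue-reflect m {i} {k} 1≤i 1≤k lt with <-cmp i k
... | tri< p _ _ = p
... | tri≈ _ refl _ = ⊥-elim (<-irrefl refl lt)
... | tri> _ _ k<i = ⊥-elim (<-asym lt (glue-mono m 1≤k k<i))

glue-inj : ∀ m {i k} → 1 ≤ i → 1 ≤ k → glue m i ≡ glue m k → i ≡ k
glue-inj m {i} {k} 1≤i 1≤k eq with <-cmp i k
... | tri< p _ _ = ⊥-elim (<-irrefl eq (glue-mono m 1≤i p))
... | tri≈ _ p _ = p
... | tri> _ _ p = ⊥-elim (<-irrefl (sym eq) (glue-mono m 1≤k p))

glue-≥1 : ∀ m {i} → 1 ≤ i → 1 ≤ glue m i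
glue-≥1 m {i} 1≤i with glue m i | view m 1≤i
... | _ | one = ≤-refl
... | _ | more p = ≤-trans (≤-trans (s≤s z≤n) p) (m≤n+m i m)

m+2 : ∀ m {j} → 2 ≤ j → 2 + m ≤ m + j
m+2 m {j} 2≤j = subst (_≤ m + j) (+-comm m 2) (+-monoʳ-≤ m 2≤j)

-- The relabelled vertices are 1 and those from m + 2 on.
glue-range : ∀ m {i} → 1 ≤ i → glue m i ≡ 1 ⊎ 2 + m ≤ glue m i
glue-range m {i} 1≤i with glue m i | view m 1≤i
... | _ | one = inj₁ refl
... | _ | more p = inj₂ (m+2 m p)

glue-second : ∀ m {i j} → 1 ≤ i → i < j → 2 + m ≤ glue m j
glue-second m {i} {j} 1≤i i<j =
  subst (2 + m ≤_) (sym (glue-≥2 m 2≤j)) (m+2 m 2≤j)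
  where
  2≤j : 2 ≤ j
  2≤j = ≤-trans (s≤s 1≤i) i<j

glue-≤ : ∀ m p {j} → 1 ≤ j → j ≤ 2 + p → glue m j ≤ 2 + (m + p)
glue-≤ m p {j} 1≤j j≤ with glue m j | view m 1≤j
... | _ | one = s≤s z≤n
... | _ | more _ = subst (m + j ≤_) (trans (+-suc m (suc p)) (cong suc (+-suc m p)))
                     (+-monoʳ-≤ m j≤)

Unglued : ℕ → ℕ → Set
Unglued m a = ∃ λ i → 1 ≤ i × a ≡ glue m i

unglue-≥ : ∀ m {a} → 2 + m ≤ a → ∃ λ i → 2 ≤ i × a ≡ glue m i
unglue-≥ m {a} m+2≤a = a ∸ m , 2≤ , sym (trans (glue-≥2 m 2≤) (m+[n∸m]≡n m≤a))
  where
  m≤a : m ≤ a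
  m≤a = ≤-trans (m≤n+m m 2) m+2≤a
  2≤ : 2 ≤ a ∸ m
  2≤ = subst (_≤ a ∸ m) (m+n∸n≡m 2 m) (∸-monoˡ-≤ m m+2≤a)

unglue : ∀ m a → 1 ≤ a → Unglued m a ⊎ (1 < a × a < 2 + m)
unglue m a 1≤a with a ≟ 1 | 2 + m ≤? a
... | yes p | _ = inj₁ (1 , ≤-refl , p)
... | no _ | yes q with unglue-≥ m q
...   | i , 2≤i , eq = inj₁ (i , ≤-trans (s≤s z≤n) 2≤i , eq)
unglue m a 1≤a | no p | no q = inj₂ (≤∧≢⇒< 1≤a (λ z → p (sym z)) , ≰⇒> q)

unglued? : ∀ m a → Dec (Unglued m a)
unglued? m zero = no λ { (i , 1≤i , eq) → <⇒≱ (glue-≥1 m 1≤i) (≤-reflexive (sym eq)) }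
unglued? m (suc a) with unglue m (suc a) (s≤s z≤n)
... | inj₁ x = yes x
... | inj₂ (1<a , a<) = no bad
  where
  bad : ¬ Unglued m (suc a)
  bad (i , 1≤i , eq) with glue-range m 1≤i
  ... | inj₁ one≡ = <-irrefl (sym (trans eq one≡)) 1<a
  ... | inj₂ ge = <⇒≱ a< (subst (2 + m ≤_) (sym eq) ge)

glue-crosses : ∀ m {i j k l} → 1 ≤ i → 1 ≤ j → 1 ≤ k → 1 ≤ l →
  Crosses (glue m i) (glue m j) (glue m k) (glue m l) → Crosses i j k l
glue-crosses m i j k l (inj₁ (p , q , r)) =
  inj₁ (glue-reflect m i k p , glue-reflect m k j q , glue-reflect m j l r)
glue-crosses m i j k l (inj₂ (p , q , r)) =
  inj₂ (glue-reflect m k i p , glue-reflect m i l q , glue-reflect m l j r)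

crosses-glue : ∀ m {i j k l} → 1 ≤ i → 1 ≤ j → 1 ≤ k → 1 ≤ l →
  Crosses i j k l → Crosses (glue m i) (glue m j) (glue m k) (glue m l)
crosses-glue m i j k l (inj₁ (p , q , r)) =
  inj₁ (glue-mono m i p , glue-mono m k q , glue-mono m j r)
crosses-glue m i j k l (inj₂ (p , q , r)) =
  inj₂ (glue-mono m k p , glue-mono m i q , glue-mono m l r)

chord-≥1 : ∀ {n i j} → Chord n i j → 1 ≤ i × 1 ≤ j
chord-≥1 (1≤i , i<j , _) = 1≤i , ≤-trans 1≤i (<⇒≤ i<j)

glue-chord : ∀ m p {i j} → Chord p i j → Chord (m + p) (glue m i) (glue m j)
glue-chord m p c@(1≤i , i<j , j≤) =
  glue-≥1 m 1≤i , glue-mono m 1≤i i<j , glue-≤ m p (proj₂ (chord-≥1 c)) j≤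

unglue-chord : ∀ m p {i j} → 1 ≤ i → 1 ≤ j → Chord (m + p) (glue m i) (glue m j) → Chord p i j
unglue-chord m p {i} {j} 1≤i 1≤j (_ , lt , le) = 1≤i , i<j , +-cancelˡ-≤ m j (2 + p) le′
  where
  i<j : i < j
  i<j = glue-reflect m 1≤i 1≤j lt
  le′ : m + j ≤ m + (2 + p)
  le′ = subst₂ _≤_ (glue-≥2 m (≤-trans (s≤s 1≤i) i<j))
          (sym (trans (+-suc m (suc p)) (cong suc (+-suc m p)))) le

-- A chord inside the first polygon and one inside the second never cross.
apart : ∀ m {a b i j} → 1 ≤ a → b ≤ 2 + m → 1 ≤ i → i < j →
        ¬ Crosses a b (glue m i) (glue m j)
apart m 1≤a b≤ 1≤i i<j (inj₁ (p , q , r)) with glue-range m 1≤i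
... | inj₁ eq = <⇒≱ (subst (_ <_) eq p) 1≤a
... | inj₂ ge = <⇒≱ q (≤-trans b≤ ge)
apart m 1≤a b≤ 1≤i i<j (inj₂ (p , q , r)) = <⇒≱ r (≤-trans b≤ (glue-second m 1≤i i<j))

plus-edges : ∀ {n₁ n₂} (T₁ : Triangulation n₁) (T₂ : Triangulation n₂) →
             EdgeSet (n₁ + n₂) (PlusEdge T₁ T₂)
plus-edges {m} {p} T₁ T₂ = record { E? = dec ; chord = ch ; noncrossing = nc ; saturated = sat }
  where
  P : Rel ℕ 0ℓ
  P = PlusEdge T₁ T₂
  dec : Decidable P
  dec a b = edge↑? T₁ a b ⊎-dec second
    where
    second : Dec (∃₂ λ i j → Edge↑ T₂ i j × a ≡ glue m i × b ≡ glue m j)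
    second with unglued? m a | unglued? m b
    ... | no ¬x | _ = no λ { (i , _ , (c , _) , eq , _) → ¬x (i , proj₁ (chord-≥1 c) , eq) }
    ... | yes _ | no ¬y = no λ { (_ , j , (c , _) , _ , eq) → ¬y (j , proj₂ (chord-≥1 c) , eq) }
    ... | yes (i , 1≤i , refl) | yes (j , 1≤j , refl) =
      mapDec (λ x → i , j , x , refl , refl) back (edge↑? T₂ i j)
      where
      back : (∃₂ λ i′ j′ → Edge↑ T₂ i′ j′ × glue m i ≡ glue m i′ × glue m j ≡ glue m j′) →
             Edge↑ T₂ i j
      back (i′ , j′ , x@(c , _) , p , q) = subst₂ (Edge↑ T₂)
        (sym (glue-inj m 1≤i (proj₁ (chord-≥1 c)) p))
        (sym (glue-inj m 1≤j (proj₂ (chord-≥1 c)) q)) x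
  ch : ∀ {a b} → P a b → Chord (m + p) a b
  ch (inj₁ ((1≤a , a<b , b≤) , _)) = 1≤a , a<b , ≤-trans b≤ (s≤s (s≤s (m≤m+n m p)))
  ch (inj₂ (i , j , (c , _) , refl , refl)) = glue-chord m p c
  nc : ∀ {a b c d} → P a b → P c d → ¬ Crosses a b c d
  nc (inj₁ x) (inj₁ y) cr = Ed.noncrossing T₁ x y cr
  nc (inj₁ ((1≤a , _ , b≤) , _)) (inj₂ (_ , _ , ((1≤i , i<j , _) , _) , refl , refl)) cr =
    apart m 1≤a b≤ 1≤i i<j cr
  nc (inj₂ (_ , _ , ((1≤i , i<j , _) , _) , refl , refl)) (inj₁ ((1≤a , _ , b≤) , _)) cr =
    apart m 1≤a b≤ 1≤i i<j (crosses-sym cr)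
  nc (inj₂ (_ , _ , x@(c , _) , refl , refl)) (inj₂ (_ , _ , y@(d , _) , refl , refl)) cr =
    Ed.noncrossing T₂ x y (glue-crosses m (proj₁ (chord-≥1 c)) (proj₂ (chord-≥1 c))
      (proj₁ (chord-≥1 d)) (proj₂ (chord-≥1 d)) cr)
  sat : ∀ {a b} → Chord (m + p) a b → (∀ {c d} → P c d → ¬ Crosses a b c d) → P a b
  sat {a} {b} cab@(1≤a , a<b , b≤) ¬cr with b ≤? 2 + m
  ... | yes b≤′ = inj₁ (Ed.saturated T₁ (1≤a , a<b , b≤′) (λ x → ¬cr (inj₁ x)))
  ... | no b≰ with unglue m a 1≤a | unglue-≥ m (<⇒≤ (≰⇒> b≰))
  ...   | inj₂ (1<a , a<) | _ = ⊥-elim (¬cr (inj₁ (full T₁)) (inj₂ (1<a , a< , ≰⇒> b≰)))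
  ...   | inj₁ (i , 1≤i , refl) | j , 2≤j , refl =
    inj₂ (i , j , Ed.saturated T₂ (unglue-chord m p 1≤i 1≤j cab)
      (λ {k} {l} x cr → ¬cr (inj₂ (k , l , x , refl , refl))
        (crosses-glue m 1≤i 1≤j (proj₁ (chord-≥1 (proj₁ x))) (proj₂ (chord-≥1 (proj₁ x))) cr))
      , refl , refl)
    where
    1≤j : 1 ≤ j
    1≤j = ≤-trans (s≤s z≤n) 2≤j

⟨plus⟩ : ∀ {n₁ n₂} → Triangulation n₁ → Triangulation n₂ → Triangulation (n₁ + n₂)
⟨plus⟩ T₁ T₂ = fromEdges (plus-edges T₁ T₂)

Tri : Set₁
Tri = ∃ Triangulation

infix 4 _≈ᵗ_
record _≈ᵗ_ (S T : Tri) : Set where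
  constructor _&_
  field
    same-size  : proj₁ S ≡ proj₁ T
    same-diags : ∀ i j → Diag (proj₂ S) i j ⇔ Diag (proj₂ T) i j

open _≈ᵗ_ public

eᵗ : Tri
eᵗ = 0 , ⟨e⟩

lamᵗ : Tri → Tri
lamᵗ (n , T) = suc n , ⟨lam⟩ T

infixr 6 _⊕ᵗ_
_⊕ᵗ_ : Tri → Tri → Tri
(m , S) ⊕ᵗ (n , T) = m + n , ⟨plus⟩ S T

to⇔ : ∀ {a b} {A : Set a} {B : Set b} → A ⇔ B → A → B
to⇔ = Equivalence.to
from⇔ : ∀ {a b} {A : Set a} {B : Set b} → A ⇔ B → B → A
from⇔ = Equivalence.from

≈-ref : ∀ {x} → x ≈ᵗ x
≈-ref = refl & λ i j → mk⇔ (λ x → x) (λ x → x)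

≈-symm : ∀ {x y} → x ≈ᵗ y → y ≈ᵗ x
≈-symm (p & f) = sym p & λ i j → mk⇔ (from⇔ (f i j)) (to⇔ (f i j))

≈-trns : ∀ {x y z} → x ≈ᵗ y → y ≈ᵗ z → x ≈ᵗ z
≈-trns (p & f) (q & g) = trans p q & λ i j →
  mk⇔ (λ x → to⇔ (g i j) (to⇔ (f i j) x)) (λ x → from⇔ (f i j) (from⇔ (g i j) x))

edge-≈ : ∀ {x y} → x ≈ᵗ y → Edge↑ (proj₂ x) ⇒ Edge↑ (proj₂ y)
edge-≈ (refl & f) (c , inj₁ s) = c , inj₁ s
edge-≈ (refl & f) (c , inj₂ d) = c , inj₂ (to⇔ (f _ _) d)

-- By maximality an inclusion of edge sets is an equality.
⊆⇒≈ : ∀ {x y} → proj₁ x ≡ proj₁ y → Edge↑ (proj₂ x) ⇒ Edge↑ (proj₂ y) → x ≈ᵗ y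
⊆⇒≈ {n , S} {_ , T} refl sub =
  refl & λ i j → mk⇔ D⊆D (S.maximal (Diag T) (Triangulation.noncrossing T) D⊆D)
  where
  module S = Triangulation S
  D⊆D : Diag S ⇒ Diag T
  D⊆D d with sub (proj₁ (proj₁ S.noncrossing d) , inj₂ d)
  ... | _ , inj₁ s = ⊥-elim (proj₂ (proj₁ S.noncrossing d) s)
  ... | _ , inj₂ d′ = d′

lam-edge : ∀ {n} (T : Triangulation n) {a b} → Edge↑ (⟨lam⟩ T) a b ⇔ LamEdge T a b
lam-edge T = fromEdges-edge (lam-edges T)

plus-edge : ∀ {m n} (S : Triangulation m) (T : Triangulation n) {a b} →
            Edge↑ (⟨plus⟩ S T) a b ⇔ PlusEdge S T a b
plus-edge S T = fromEdges-edge (plus-edges S T)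

from-P : ∀ {m n} (S : Triangulation m) (T : Triangulation n) {a b} →
         PlusEdge S T a b → Edge↑ (⟨plus⟩ S T) a b
from-P S T = from⇔ (plus-edge S T)

lamᵗ-cong : ∀ {x y} → x ≈ᵗ y → lamᵗ x ≈ᵗ lamᵗ y
lamᵗ-cong {m , S} {.m , T} eq@(refl & _) = ⊆⇒≈ refl λ x → from⇔ (lam-edge T) (go (to⇔ (lam-edge S) x))
  where
  go : LamEdge S ⇒ LamEdge T
  go (inj₁ x) = inj₁ x
  go (inj₂ (i , j , x , p , q)) = inj₂ (i , j , edge-≈ eq x , p , q)

⊕ᵗ-cong : ∀ {x x′ y y′} → x ≈ᵗ x′ → y ≈ᵗ y′ → x ⊕ᵗ y ≈ᵗ x′ ⊕ᵗ y′
⊕ᵗ-cong {m , S} {.m , S′} {n , T} {.n , T′} eq@(refl & _) eq′@(refl & _) =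
  ⊆⇒≈ refl λ x → from-P S′ T′ (go (to⇔ (plus-edge S T) x))
  where
  go : PlusEdge S T ⇒ PlusEdge S′ T′
  go (inj₁ x) = inj₁ (edge-≈ eq x)
  go (inj₂ (i , j , x , p , q)) = inj₂ (i , j , edge-≈ eq′ x , p , q)

glue-0 : ∀ {i} → 1 ≤ i → glue 0 i ≡ i
glue-0 {suc zero} _ = refl
glue-0 {suc (suc i)} _ = refl

glue-glue : ∀ m n {i} → 1 ≤ i → glue (m + n) i ≡ glue m (glue n i)
glue-glue m n {suc zero} _ = refl
glue-glue m n {suc (suc i)} _ = trans (+-assoc m n (2 + i))
  (sym (glue-≥2 m (≤-trans (s≤s (s≤s z≤n)) (m≤n+m (2 + i) n))))

⊕ᵗ-assoc : ∀ x y z → (x ⊕ᵗ y) ⊕ᵗ z ≈ᵗ x ⊕ᵗ (y ⊕ᵗ z)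
⊕ᵗ-assoc (l , R) (m , S) (n , T) = ⊆⇒≈ (+-assoc l m n)
  λ x → from-P R (⟨plus⟩ S T) (go (to⇔ (plus-edge (⟨plus⟩ R S) T) x))
  where
  go : PlusEdge (⟨plus⟩ R S) T ⇒ PlusEdge R (⟨plus⟩ S T)
  go (inj₁ x) with to⇔ (plus-edge R S) x
  ... | inj₁ y = inj₁ y
  ... | inj₂ (i , j , y , p , q) = inj₂ (i , j , from-P S T (inj₁ y) , p , q)
  go (inj₂ (i , j , x@(c , _) , p , q)) = inj₂ (glue m i , glue m j
    , from-P S T (inj₂ (i , j , x , refl , refl))
    , trans p (glue-glue l m (proj₁ (chord-≥1 c)))
    , trans q (glue-glue l m (proj₂ (chord-≥1 c))))

⊕ᵗ-identityˡ : ∀ x → eᵗ ⊕ᵗ x ≈ᵗ x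
⊕ᵗ-identityˡ x@(n , T) = ≈-symm (⊆⇒≈ refl λ {i} {j} y → from-P ⟨e⟩ T (inj₂ (i , j , y
  , sym (glue-0 (proj₁ (chord-≥1 (proj₁ y)))) , sym (glue-0 (proj₂ (chord-≥1 (proj₁ y)))))))

⊕ᵗ-identityʳ : ∀ x → x ⊕ᵗ eᵗ ≈ᵗ x
⊕ᵗ-identityʳ x@(n , T) = ≈-symm (⊆⇒≈ (sym (+-identityʳ n)) λ y → from-P T ⟨e⟩ (inj₁ y))

zeroᵗ : ∀ x → proj₁ x ≡ 0 → x ≈ᵗ eᵗ
zeroᵗ (.0 , T) refl = ≈-symm (⊆⇒≈ refl λ x → go (to⇔ (fromEdges-edge ⟨e⟩-edges) x))
  where
  go : ∀ {a b} → a ≡ 1 × b ≡ 2 → Edge↑ T a b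
  go (refl , refl) = full T

-- lam u ⊕ v is determined by its root triangle (1 , 2 , m + 3).

node-root : ∀ {m p} (U : Triangulation m) (V : Triangulation p) →
            Edge↑ (⟨plus⟩ (⟨lam⟩ U) V) 1 (3 + m)
node-root U V = from-P (⟨lam⟩ U) V (inj₁ (full (⟨lam⟩ U)))

node-¬root : ∀ {m p} (U : Triangulation m) (V : Triangulation p) {l} →
             2 < l → l < 3 + m → ¬ Edge↑ (⟨plus⟩ (⟨lam⟩ U) V) 1 l
node-¬root {m} U V 2<l l< x with to⇔ (plus-edge (⟨lam⟩ U) V) x
... | inj₂ (i , j , ((1≤i , i<j , _) , _) , _ , refl) =
  <⇒≱ l< (glue-second (suc m) 1≤i i<j)
... | inj₁ y with to⇔ (lam-edge U) y
...   | inj₁ (_ , inj₁ refl) = <-irrefl refl 2<l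
...   | inj₁ (_ , inj₂ refl) = <⇒≱ l< (≤-reflexive (+-comm 3 m))
...   | inj₂ (zero , _ , ((() , _) , _) , _ , _)
...   | inj₂ (suc _ , _ , _ , () , _)

node-root-≤ : ∀ {m p m′ p′} (U : Triangulation m) (V : Triangulation p)
  (U′ : Triangulation m′) (V′ : Triangulation p′) →
  lamᵗ (m , U) ⊕ᵗ (p , V) ≈ᵗ lamᵗ (m′ , U′) ⊕ᵗ (p′ , V′) → m′ ≤ m
node-root-≤ U V U′ V′ eq = ≮⇒≥ λ m<m′ →
  node-¬root U′ V′ (s≤s (s≤s (s≤s z≤n))) (s≤s (s≤s (s≤s m<m′))) (edge-≈ eq (node-root U V))

nodeᵗ-unique : ∀ u v u′ v′ → lamᵗ u ⊕ᵗ v ≈ᵗ lamᵗ u′ ⊕ᵗ v′ → u ≈ᵗ u′ × v ≈ᵗ v′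
nodeᵗ-unique (m , U) (p , V) (m′ , U′) (p′ , V′) eq
  with ≤-antisym (node-root-≤ U′ V′ U V (≈-symm eq)) (node-root-≤ U V U′ V′ eq)
... | refl with +-cancelˡ-≡ (suc m) p p′ (same-size eq)
...   | refl = ⊆⇒≈ refl U⊆ , ⊆⇒≈ refl V⊆
  where
  move : ∀ {a b} → PlusEdge (⟨lam⟩ U) V a b → PlusEdge (⟨lam⟩ U′) V′ a b
  move x = to⇔ (plus-edge (⟨lam⟩ U′) V′) (edge-≈ eq (from-P (⟨lam⟩ U) V x))
  U⊆ : Edge↑ U ⇒ Edge↑ U′
  U⊆ {i} {j} x@((1≤i , i<j , j≤) , _)
    with move (inj₁ (from⇔ (lam-edge U) (inj₂ (i , j , x , refl , refl))))
  ... | inj₂ (k , l , ((1≤k , _ , _) , _) , a≡ , b≡) with glue-range (suc m) 1≤k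
  ...   | inj₁ one≡ = ⊥-elim (<-irrefl (sym (trans a≡ one≡)) (s≤s 1≤i))
  ...   | inj₂ ge = ⊥-elim (<⇒≱ (s≤s i<j) (≤-trans (s≤s j≤) (subst (3 + m ≤_) (sym a≡) ge)))
  U⊆ {i} {j} x@((1≤i , i<j , j≤) , _) | inj₁ y with to⇔ (lam-edge U′) y
  ... | inj₁ (refl , _) = ⊥-elim (<⇒≱ 1≤i z≤n)
  ... | inj₂ (_ , _ , z , refl , refl) = z
  V⊆ : Edge↑ V ⇒ Edge↑ V′
  V⊆ {i} {j} x@(c@(1≤i , i<j , j≤) , _) with move (inj₂ (i , j , x , refl , refl))
  ... | inj₂ (k , l , z@(d , _) , a≡ , b≡) = subst₂ (Edge↑ V′)
        (sym (glue-inj (suc m) 1≤i (proj₁ (chord-≥1 d)) a≡))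
        (sym (glue-inj (suc m) (proj₂ (chord-≥1 c)) (proj₂ (chord-≥1 d)) b≡)) z
  ... | inj₁ ((_ , lt , b≤) , _) with glue-range (suc m) 1≤i
  ...   | inj₂ ge = ⊥-elim (<⇒≱ lt (≤-trans b≤ ge))
  ...   | inj₁ a≡ = Ed.side⇒E V′ c (inj₁ (trans j≡2 (sym (cong suc i≡1))))
    where
    i≡1 : i ≡ 1
    i≡1 = glue-inj (suc m) 1≤i (s≤s z≤n) a≡
    j≡2 : j ≡ 2
    j≡2 = glue-inj (suc m) (proj₂ (chord-≥1 c)) (s≤s z≤n)
      (trans (≤-antisym b≤ (glue-second (suc m) 1≤i i<j)) (+-comm 2 (suc m)))

least : ∀ {ℓ} {P : ℕ → Set ℓ} → (∀ k → Dec (P k)) → ∀ n → P n →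
        ∃₂ λ m p → m + p ≡ n × P m × (∀ k → k < m → ¬ P k)
least P? zero Pn = 0 , 0 , refl , Pn , λ _ ()
least {P = P} P? (suc n) Pn with P? 0
... | yes p0 = 0 , suc n , refl , p0 , λ _ ()
... | no ¬p0 with least {P = λ k → P (suc k)} (λ k → P? (suc k)) n Pn
...   | m , p , eq , Pm , min = suc m , p , cong suc eq , Pm , below
  where
  below : ∀ k → k < suc m → ¬ P k
  below zero _ = ¬p0
  below (suc k) (s≤s lt) = min k lt

module Split (m p : ℕ) (T : Triangulation (suc m + p))
             (root : Edge↑ T 1 (3 + m))
             (minimal : ∀ k → k < m → ¬ Edge↑ T 1 (3 + k)) where

  -- An edge with lower endpoint in 2, …, m + 2 stays within 2, …, m + 3.
  inside : ∀ {k l} → Edge↑ T k l → 1 < k → k < 3 + m → l ≤ 3 + m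
  inside x 1<k k< = ≮⇒≥ λ <l → Ed.noncrossing T root x (inj₁ (1<k , k< , <l))

  from-1 : ∀ {l} → Edge↑ T 1 l → l < 3 + m → l ≡ 2
  from-1 {suc (suc (suc l))} x (s≤s (s≤s (s≤s lt))) = ⊥-elim (minimal l lt x)
  from-1 {suc (suc zero)} x _ = refl
  from-1 {suc zero} ((_ , s≤s () , _) , _) _
  from-1 {zero} ((_ , () , _) , _) _

  UEdge VEdge : Rel ℕ 0ℓ
  UEdge i j = Chord m i j × Edge↑ T (suc i) (suc j)
  VEdge i j = Chord p i j × Edge↑ T (glue (suc m) i) (glue (suc m) j)

  U-edges : EdgeSet m UEdge
  U-edges = record
    { E?          = λ i j → chord? m i j ×-dec edge↑? T (suc i) (suc j)
    ; chord       = proj₁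
    ; noncrossing = λ x y cr → Ed.noncrossing T (proj₂ x) (proj₂ y) (unshift-crosses cr)
    ; saturated   = sat
    }
    where
    sat : ∀ {i j} → Chord m i j → (∀ {k l} → UEdge k l → ¬ Crosses i j k l) → UEdge i j
    sat {i} {j} c@(1≤i , i<j , j≤) ¬cr = c , Ed.saturated T
      (s≤s z≤n , s≤s i<j , ≤-trans (s≤s j≤) (s≤s (s≤s (s≤s (m≤m+n m p))))) bad
      where
      bad : ∀ {k l} → Edge↑ T k l → ¬ Crosses (suc i) (suc j) k l
      bad {zero} ((() , _) , _)
      bad {suc zero} _ (inj₁ (s≤s () , _ , _))
      bad {suc zero} x (inj₂ (_ , i<l , l<j))
        with from-1 x (≤-trans l<j (s≤s j≤))
      ... | refl = <⇒≱ i<l (s≤s 1≤i)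
      bad {suc (suc k)} {zero} ((_ , () , _) , _)
      bad {suc (suc k)} {suc l} x@((_ , s≤s k<l , _) , _) cr =
        ¬cr ((s≤s z≤n , k<l , ≤-pred (inside x (s≤s (s≤s z≤n)) (k< cr))) , x) (shift-crosses cr)
        where
        k< : Crosses (suc i) (suc j) (suc (suc k)) (suc l) → suc (suc k) < 3 + m
        k< (inj₁ (_ , q , _)) = ≤-trans q (s≤s j≤)
        k< (inj₂ (q , _ , _)) = ≤-trans q (≤-trans (s≤s (<⇒≤ i<j)) (s≤s j≤))

  V-edges : EdgeSet p VEdge
  V-edges = record
    { E?          = λ i j → chord? p i j ×-dec edge↑? T (glue (suc m) i) (glue (suc m) j)
    ; chord       = proj₁
    ; noncrossing = λ { (c , x) (d , y) cr → Ed.noncrossing T x y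
        (crosses-glue (suc m) (proj₁ (chord-≥1 c)) (proj₂ (chord-≥1 c))
          (proj₁ (chord-≥1 d)) (proj₂ (chord-≥1 d)) cr) }
    ; saturated   = sat
    }
    where
    g : ℕ → ℕ
    g = glue (suc m)
    sat : ∀ {i j} → Chord p i j → (∀ {k l} → VEdge k l → ¬ Crosses i j k l) → VEdge i j
    sat {i} {j} c@(1≤i , i<j , j≤) ¬cr = c , Ed.saturated T (glue-chord (suc m) p c) bad
      where
      1≤j : 1 ≤ j
      1≤j = proj₂ (chord-≥1 c)
      bad : ∀ {k l} → Edge↑ T k l → ¬ Crosses (g i) (g j) k l
      bad {k} {l} x@(d , _) cr
        with unglue (suc m) k (proj₁ (chord-≥1 d)) | unglue (suc m) l (proj₂ (chord-≥1 d))
      ... | inj₂ (1<k , k<) | _ =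
        apart (suc m) (<⇒≤ 1<k) (inside x 1<k k<) 1≤i i<j (crosses-sym cr)
      ... | inj₁ (k′ , 1≤k′ , refl) | inj₂ (1<l , l<) =
        apart (suc m) (proj₁ d) (<⇒≤ l<) 1≤i i<j (crosses-sym cr)
      ... | inj₁ (k′ , 1≤k′ , refl) | inj₁ (l′ , 1≤l′ , refl) =
        ¬cr (unglue-chord (suc m) p 1≤k′ 1≤l′ d , x) (glue-crosses (suc m) 1≤i 1≤j 1≤k′ 1≤l′ cr)

  U : Triangulation m
  U = fromEdges U-edges

  V : Triangulation p
  V = fromEdges V-edges

  split : (suc m + p , T) ≈ᵗ lamᵗ (m , U) ⊕ᵗ (p , V)
  split = ≈-symm (⊆⇒≈ refl λ x → go (to⇔ (plus-edge (⟨lam⟩ U) V) x))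
    where
    side : ∀ {a b} → Chord (suc m) a b → b ≡ suc a → Edge↑ T a b
    side (1≤a , a<b , b≤) eq =
      Ed.side⇒E T (1≤a , a<b , ≤-trans b≤ (s≤s (s≤s (s≤s (m≤m+n m p))))) (inj₁ eq)
    go : PlusEdge (⟨lam⟩ U) V ⇒ Edge↑ T
    go (inj₂ (i , j , x , refl , refl)) = proj₂ (to⇔ (fromEdges-edge V-edges) x)
    go (inj₁ x) with to⇔ (lam-edge U) x
    ... | inj₁ (refl , inj₁ refl) = side (proj₁ x) refl
    ... | inj₁ (refl , inj₂ refl) = subst (Edge↑ T 1) (+-comm 3 m) root
    ... | inj₂ (i , j , y , refl , refl) = proj₂ (to⇔ (fromEdges-edge U-edges) y)

splitᵗ : ∀ n (T : Triangulation (suc n)) → ∃₂ λ u v → (suc n , T) ≈ᵗ lamᵗ u ⊕ᵗ v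
splitᵗ n T with least (λ k → edge↑? T 1 (3 + k)) n (full T)
... | m , p , refl , root , minimal = (m , U) , (p , V) , split
  where open Split m p T root minimal

triangulations : CatalanStructure (lsuc 0ℓ) 0ℓ
triangulations = record
  { Carrier = Tri ; _≈_ = _≈ᵗ_ ; size = proj₁ ; e = eᵗ ; lam = lamᵗ ; _⊕_ = _⊕ᵗ_
  ; ⊕-isMonoid = record
    { isSemigroup = record
      { isMagma = record
        { isEquivalence = record { refl = ≈-ref ; sym = ≈-symm ; trans = ≈-trns }
        ; ∙-cong = ⊕ᵗ-cong }
      ; assoc = ⊕ᵗ-assoc }
    ; identity = ⊕ᵗ-identityˡ , ⊕ᵗ-identityʳ }
  ; lam-cong = lamᵗ-cong
  ; size-cong = same-size
  ; size-e = refl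
  ; size-zero = zeroᵗ
  ; size-lam = λ _ → refl
  ; size-⊕ = λ _ _ → refl
  ; cover = cover
  ; e-indec = λ t≈e (s , t≈) → 0≢1+n (trans (sym (same-size t≈e)) (same-size t≈))
  ; e-decomp = λ { t≈e ((s , u≈) , _ , t≈) →
      0≢1+n (trans (sym (same-size t≈e)) (trans (same-size t≈) (cong (_+ _) (same-size u≈)))) }
  ; indec-decomp = λ { {t} {u} {v} (s , t≈s) ((r , u≈) , ¬v , t≈) →
      ¬v (≈-symm (proj₂ (nodeᵗ-unique s eᵗ r v
        (≈-trns (⊕ᵗ-identityʳ (lamᵗ s))
          (≈-trns (≈-symm t≈s) (≈-trns t≈ (⊕ᵗ-cong u≈ ≈-ref))))))) }
  ; lam-unique = λ {s} {s′} eq → proj₁ (nodeᵗ-unique s eᵗ s′ eᵗ (⊕ᵗ-cong eq ≈-ref))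
  ; ⊕-unique = λ { {t} {u} {v} {u′} {v′} ((s , u≈) , _ , t≈) ((s′ , u′≈) , _ , t≈′) →
      let ss , vv = nodeᵗ-unique s v s′ v′
            (≈-trns (≈-symm (⊕ᵗ-cong u≈ ≈-ref))
              (≈-trns (≈-symm t≈) (≈-trns t≈′ (⊕ᵗ-cong u′≈ ≈-ref))))
      in ≈-trns u≈ (≈-trns (lamᵗ-cong ss) (≈-symm u′≈)) , vv }
  }
  where
  Decomposed : Tri → Set₁
  Decomposed t = ∃₂ λ u v → (∃ λ s → u ≈ᵗ lamᵗ s) × ¬ (v ≈ᵗ eᵗ) × t ≈ᵗ u ⊕ᵗ v
  cover : ∀ t → t ≈ᵗ eᵗ ⊎ (∃ λ s → t ≈ᵗ lamᵗ s) ⊎ Decomposed t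
  cover (zero , T) = inj₁ (zeroᵗ (zero , T) refl)
  cover (suc n , T) with splitᵗ n T
  ... | u , v@(zero , V) , eq = inj₂ (inj₁ (u ,
    ≈-trns eq (≈-trns (⊕ᵗ-cong ≈-ref (zeroᵗ v refl)) (⊕ᵗ-identityʳ (lamᵗ u)))))
  ... | u , v@(suc _ , V) , eq =
    inj₂ (inj₂ (lamᵗ u , v , (u , ≈-ref) , (λ v≈e → 0≢1+n (sym (same-size v≈e))) , eq))

{-# OPTIONS --safe #-}

-- Geometrically A ⊖ B glues the edge (1 , n + 2) of B onto the last side
-- (m + 1 , m + 2) of A: this is the reflection of the gluing ⊕, which uses the
-- edge (1 , m + 2) of the first summand and the side (1 , 2) of the second. So
-- reflection turns u ⊕ v into mirror v ⊖ mirror u; it also turns λ into γ, and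
-- therefore satisfies the recursion defining h. Each equality of triangulations
-- is reduced to an inclusion of edge sets by maximality.
module Submission where

open import Defs using (Triangulation; Edge; triangulations; module Operations)
open import Data.Nat using (ℕ; _+_; _∸_)
open import Data.Product using (∃₂; _×_; _,_; proj₁; proj₂)
open import Function.Bundles using (_⇔_)
open import Relation.Binary.PropositionalEquality using (_≡_)

open import Defs using
  ( Chord; Crosses; EdgeSet; Edge↑; module Ed; fromEdges; fromEdges-edge; full; glue; glue-≥2
  ; chord?; edge↑?; chord-≥1; lam-edge; plus-edge; from-P; LamEdge; PlusEdge; ⟨lam⟩; ⟨plus⟩; ⟨e⟩
  ; Tri; _≈ᵗ_; same-size; eᵗ; lamᵗ; _⊕ᵗ_; to⇔; from⇔; ≈-ref; ≈-symm; ≈-trns; edge-≈; ⊆⇒≈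
  ; ⊕ᵗ-cong; ⊕ᵗ-identityʳ; zeroᵗ )
open import Data.Empty using (⊥-elim)
open import Data.Nat using (suc; _≤_; _<_; z≤n; s≤s)
open import Data.Nat.Properties
open import Data.Sum using (inj₁; inj₂)
open import Function.Base using (_∘_)
open import Function.Bundles using (mk⇔)
open import Level using (0ℓ)
open import Relation.Binary.Construct.Closure.Symmetric using (fwd; bwd)
open import Relation.Binary.Core using (Rel)
open import Relation.Binary.PropositionalEquality
  using (refl; sym; trans; cong; subst; subst₂; module ≡-Reasoning)
open import Relation.Nullary using (¬_)
open import Relation.Nullary.Decidable using (_×-dec_)

open Operations triangulations using (Form; empty; node; form; minus; _⊖_; γ; h; h′; ⊖-cong)

-- Reflection of vertices, chords and triangulations.

reflect : ℕ → ℕ → ℕ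
reflect n i = n + 3 ∸ i

≤-n+3 : ∀ {n i} → i ≤ 2 + n → i ≤ n + 3
≤-n+3 {n} i≤ = ≤-trans i≤ (≤-trans (n≤1+n _) (≤-reflexive (+-comm 3 n)))

reflect-< : ∀ {n i j} → i < j → j ≤ 2 + n → reflect n j < reflect n i
reflect-< i<j j≤ = ∸-monoʳ-< i<j (≤-n+3 j≤)

reflect-involutive : ∀ {n i} → i ≤ 2 + n → reflect n (reflect n i) ≡ i
reflect-involutive i≤ = m∸[m∸n]≡n (≤-n+3 i≤)

reflect-1 : ∀ n → reflect n 1 ≡ 2 + n
reflect-1 n = cong (_∸ 1) (+-comm n 3)

reflect-2 : ∀ n → reflect n 2 ≡ 1 + n
reflect-2 n = cong (_∸ 2) (+-comm n 3)

chord-≤ : ∀ {n i j} → Chord n i j → i ≤ 2 + n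
chord-≤ (_ , i<j , j≤) = ≤-trans (<⇒≤ i<j) j≤

reflect-chord : ∀ {n i j} → Chord n i j → Chord n (reflect n j) (reflect n i)
reflect-chord {n} {i} {j} (1≤i , i<j , j≤) =
  m<n⇒0<n∸m (subst (j <_) (+-comm 3 n) (s≤s j≤)) ,
  reflect-< i<j j≤ ,
  ≤-trans (∸-monoʳ-≤ (n + 3) 1≤i) (≤-reflexive (reflect-1 n))

reflect-crosses : ∀ {n i j k l} → Chord n i j → Chord n k l → Crosses i j k l →
                  Crosses (reflect n j) (reflect n i) (reflect n l) (reflect n k)
reflect-crosses (_ , _ , j≤) d@(_ , _ , l≤) (inj₁ (p , q , r)) =
  inj₂ (reflect-< r l≤ , reflect-< q j≤ , reflect-< p (chord-≤ d))
reflect-crosses c@(_ , _ , j≤) (_ , _ , l≤) (inj₂ (p , q , r)) =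
  inj₁ (reflect-< r j≤ , reflect-< q l≤ , reflect-< p (chord-≤ c))

-- Reflection reverses the order of vertices, so the endpoints are exchanged to keep the smaller one
-- first. Taking a preimage rather than an image makes decidability immediate.
MirrorEdge : ∀ {n} → Triangulation n → Rel ℕ 0ℓ
MirrorEdge {n} T a b = Chord n a b × Edge↑ T (reflect n b) (reflect n a)

reflect-edge : ∀ {n} (T : Triangulation n) {i j} → Edge↑ T i j →
               MirrorEdge T (reflect n j) (reflect n i)
reflect-edge T x@(c@(_ , _ , j≤) , _) = reflect-chord c ,
  subst₂ (Edge↑ T) (sym (reflect-involutive (chord-≤ c))) (sym (reflect-involutive j≤)) x

mirror-edges : ∀ {n} (T : Triangulation n) → EdgeSet n (MirrorEdge T)
mirror-edges {n} T = record
  { E?          = λ a b → chord? n a b ×-dec edge↑? T (reflect n b) (reflect n a)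
  ; chord       = proj₁
  ; noncrossing = λ { (c , x) (d , y) cr → Ed.noncrossing T x y (reflect-crosses c d cr) }
  ; saturated   = sat
  }
  where
  sat : ∀ {a b} → Chord n a b → (∀ {k l} → MirrorEdge T k l → ¬ Crosses a b k l) →
        MirrorEdge T a b
  -- An edge of `T` crossing the reflected chord would reflect back to a mirror edge crossing the
  -- chord from `a` to `b`.
  sat {a} {b} c@(_ , _ , b≤) ¬cr = c , Ed.saturated T (reflect-chord c) λ {k} {l} x cr →
    ¬cr (reflect-edge T x)
      (subst₂ (λ i j → Crosses i j (reflect n l) (reflect n k))
        (reflect-involutive (chord-≤ c)) (reflect-involutive b≤)
        (reflect-crosses (reflect-chord c) (proj₁ x) cr))

⟨mirror⟩ : ∀ {n} → Triangulation n → Triangulation n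
⟨mirror⟩ T = fromEdges (mirror-edges T)

mirror : Tri → Tri
mirror (n , T) = n , ⟨mirror⟩ T

mirror-edge : ∀ {n} (T : Triangulation n) {a b} → Edge↑ (⟨mirror⟩ T) a b ⇔ MirrorEdge T a b
mirror-edge T = fromEdges-edge (mirror-edges T)

mirror-edge⁺ : ∀ {n} (T : Triangulation n) {i j} → Edge↑ T i j →
               Edge↑ (⟨mirror⟩ T) (reflect n j) (reflect n i)
mirror-edge⁺ T x = from⇔ (mirror-edge T) (reflect-edge T x)

-- Since reflection is an involution, every mirror edge is the reflection of an edge of `T`. This is
-- how inclusions out of a mirror image are proved.
mirror-⊆ : ∀ {n} (T : Triangulation n) (P : Rel ℕ 0ℓ) →
           (∀ {i j} → Edge↑ T i j → P (reflect n j) (reflect n i)) →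
           ∀ {a b} → Edge↑ (⟨mirror⟩ T) a b → P a b
mirror-⊆ T P f x with to⇔ (mirror-edge T) x
... | c@(_ , _ , b≤) , y =
  subst₂ P (reflect-involutive (chord-≤ c)) (reflect-involutive b≤) (f y)

mirror-cong : ∀ {x y} → x ≈ᵗ y → mirror x ≈ᵗ mirror y
mirror-cong {n , S} {_ , T} eq with same-size eq
... | refl = ⊆⇒≈ refl (mirror-⊆ S (Edge↑ (⟨mirror⟩ T)) λ x → mirror-edge⁺ T (edge-≈ eq x))

mirror-lam : ∀ u → mirror (lamᵗ u) ≈ᵗ γ (mirror u)
mirror-lam (m , U) = ⊆⇒≈ size≡ (mirror-⊆ (⟨lam⟩ U) (Edge↑ G) λ x → go x (to⇔ (lam-edge U) x))
  where
  G : Triangulation (m + 1)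
  G = ⟨plus⟩ (⟨mirror⟩ U) (⟨lam⟩ ⟨e⟩)
  size≡ : suc m ≡ m + 1
  size≡ = +-comm 1 m
  chord : ∀ {i j} → Edge↑ (⟨lam⟩ U) i j → Chord (m + 1) (reflect (suc m) j) (reflect (suc m) i)
  chord {i} {j} (c , _) = subst (λ k → Chord k (reflect (suc m) j) (reflect (suc m) i)) size≡
    (reflect-chord c)
  go : ∀ {i j} → Edge↑ (⟨lam⟩ U) i j → LamEdge U i j →
       Edge↑ G (reflect (suc m) j) (reflect (suc m) i)
  -- The two edges at the new vertex become the sides (m + 2 , m + 3) and (1 , m + 3).
  go x (inj₁ (refl , inj₁ refl)) =
    Ed.side⇒E G (chord x) (inj₁ (trans (reflect-1 (suc m)) (cong suc (sym (reflect-2 (suc m))))))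
  go x (inj₁ (refl , inj₂ refl)) =
    Ed.side⇒E G (chord x) (inj₂ (m+n∸n≡m 1 (m + 3) ,
      trans (reflect-1 (suc m)) (cong (2 +_) size≡)))
  -- The shift cancels the larger size: `reflect (suc m) (suc i)` computes to `reflect m i`.
  go _ (inj₂ (_ , _ , y , refl , refl)) =
    from-P (⟨mirror⟩ U) (⟨lam⟩ ⟨e⟩) (inj₁ (mirror-edge⁺ U y))

-- Gluing onto the last side, and the operation `_⊖_`.

-- C consists of A and B with the edge (1 , |B| + 2) of B glued onto the last
-- side of A: the last vertex of A becomes the last vertex of C.
record Stack (A B C : Tri) : Set where
  field
    size  : proj₁ C ≡ proj₁ A + proj₁ B
    lower : ∀ {i j} → Edge↑ (proj₂ A) i j → j ≤ 1 + proj₁ A → Edge↑ (proj₂ C) i j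
    last  : ∀ {i} → Edge↑ (proj₂ A) i (2 + proj₁ A) → Edge↑ (proj₂ C) i (2 + proj₁ C)
    upper : ∀ {i j} → Edge↑ (proj₂ B) i j → Edge↑ (proj₂ C) (proj₁ A + i) (proj₁ A + j)

stack-respˡ : ∀ {A A′ B C} → A ≈ᵗ A′ → Stack A B C → Stack A′ B C
stack-respˡ eq s with same-size eq
... | refl = record
  { size  = size
  ; lower = λ x → lower (edge-≈ (≈-symm eq) x)
  ; last  = λ x → last (edge-≈ (≈-symm eq) x)
  ; upper = upper
  }
  where open Stack s

stack-e : ∀ B → Stack eᵗ B B
stack-e (n , T) = record
  { size  = refl
  ; lower = λ { ((1≤i , i<j , _) , _) j≤1 → ⊥-elim (<⇒≱ i<j (≤-trans j≤1 1≤i)) }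
  -- The single edge (1 , 2) is its own last side, and becomes the edge (1 , n + 2) of `T`.
  ; last  = λ { ((1≤i , i<2 , _) , _) →
      subst (λ i → Edge↑ T i (2 + n)) (≤-antisym 1≤i (≤-pred i<2)) (full T) }
  ; upper = λ x → x
  }

stack-lam : ∀ {A B C} → Stack A B C → Stack (lamᵗ A) B (lamᵗ C)
stack-lam {a , A} {b , B} {c , C} s = record
  { size  = cong suc size
  ; lower = λ x → from⇔ (lam-edge C) ∘ low (to⇔ (lam-edge A) x)
  ; last  = λ x → top (to⇔ (lam-edge A) x) refl
  ; upper = λ x → from⇔ (lam-edge C) (inj₂ (_ , _ , upper x , refl , refl))
  }
  where
  open Stack s
  low : ∀ {i j} → LamEdge A i j → j ≤ 2 + a → LamEdge C i j
  low (inj₁ (refl , inj₁ refl)) _ = inj₁ (refl , inj₁ refl)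
  low (inj₁ (refl , inj₂ refl)) le = ⊥-elim (<⇒≱ ≤-refl (subst (_≤ 2 + a) (+-comm a 3) le))
  low (inj₂ (_ , _ , x , refl , refl)) (s≤s le) = inj₂ (_ , _ , lower x le , refl , refl)
  top : ∀ {i j} → LamEdge A i j → j ≡ 3 + a → Edge↑ (⟨lam⟩ C) i (3 + c)
  top (inj₁ (refl , _)) _ = full (⟨lam⟩ C)
  top (inj₂ (_ , _ , x , refl , refl)) refl =
    from⇔ (lam-edge C) (inj₂ (_ , _ , last x , refl , refl))

-- As `A` is nonempty, the last vertex of `D ⊕ᵗ A` comes from `A`, so no edge of `D` has to be
-- moved. Also `proj₁ A + i` is then at least 2, where `glue` is a translation.
stack-⊕ : ∀ D {A B C} → 1 ≤ proj₁ A → Stack A B C → Stack (D ⊕ᵗ A) B (D ⊕ᵗ C)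
stack-⊕ (d , D) {a , A} {b , B} {c , C} 1≤a s = record
  { size  = trans (cong (d +_) size) (sym (+-assoc d a b))
  ; lower = λ x → low (to⇔ (plus-edge D A) x)
  ; last  = λ x → top (to⇔ (plus-edge D A) x) refl
  ; upper = λ { x@(ch@(1≤i , _) , _) → subst₂ (Edge↑ (⟨plus⟩ D C))
      (shift 1≤i) (shift (proj₂ (chord-≥1 ch))) (glued (upper x)) }
  }
  where
  open Stack s
  glued : ∀ {i j} → Edge↑ C i j → Edge↑ (⟨plus⟩ D C) (glue d i) (glue d j)
  glued x = from-P D C (inj₂ (_ , _ , x , refl , refl))
  shift : ∀ {i} → 1 ≤ i → glue d (a + i) ≡ d + a + i
  shift {i} 1≤i = trans (glue-≥2 d (+-mono-≤ 1≤a 1≤i)) (sym (+-assoc d a i))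
  glue-upper : ∀ {i j} → Edge↑ A i j → glue d j ≡ d + j
  glue-upper ((1≤i , i<j , _) , _) = glue-≥2 d (≤-trans (s≤s 1≤i) i<j)
  d+ : ∀ k m → d + (k + m) ≡ k + (d + m)
  d+ k m = trans (sym (+-assoc d k m)) (trans (cong (_+ m) (+-comm d k)) (+-assoc k d m))
  low : ∀ {i j} → PlusEdge D A i j → j ≤ 1 + (d + a) → Edge↑ (⟨plus⟩ D C) i j
  low (inj₁ x) _ = from-P D C (inj₁ x)
  low (inj₂ (_ , j , x , refl , refl)) le = glued (lower x (+-cancelˡ-≤ d _ _
    (subst₂ _≤_ (glue-upper x) (sym (d+ 1 a)) le)))
  top : ∀ {i j} → PlusEdge D A i j → j ≡ 2 + (d + a) → Edge↑ (⟨plus⟩ D C) i (2 + (d + c))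
  top (inj₁ ((_ , _ , j≤) , _)) refl =
    ⊥-elim (<⇒≱ 1≤a (+-cancelˡ-≤ d _ _
      (subst (d + a ≤_) (sym (+-identityʳ d)) (≤-pred (≤-pred j≤)))))
  top (inj₂ (i , j , x , refl , refl)) eq =
    subst (Edge↑ (⟨plus⟩ D C) (glue d i)) (d+ 2 c)
      (glued (last (subst (Edge↑ A i) j≡ x)))
    where
    j≡ : j ≡ 2 + a
    j≡ = +-cancelˡ-≡ d j (2 + a) (trans (sym (glue-upper x)) (trans eq (sym (d+ 2 a))))

node-nonempty : ∀ {u v t} → t ≈ᵗ lamᵗ u ⊕ᵗ v → 1 ≤ proj₁ t
node-nonempty eq = subst (1 ≤_) (sym (same-size eq)) (s≤s z≤n)

-- Induction along the three clauses of `minus`, each matched by one of the stacking lemmas above.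
minus-stack : ∀ {t} (p : Form t) v → Stack t v (minus p v)
minus-stack (empty t≈e) v = stack-respˡ (≈-symm t≈e) (stack-e v)
minus-stack (node {u} p (empty w≈e) t≈) v =
  stack-respˡ (≈-symm (≈-trns t≈ (≈-trns (⊕ᵗ-cong ≈-ref w≈e) (⊕ᵗ-identityʳ (lamᵗ u)))))
    (stack-lam (minus-stack p v))
minus-stack (node {u} p q@(node _ _ w≈) t≈) v =
  stack-respˡ (≈-symm t≈) (stack-⊕ (lamᵗ u) (node-nonempty w≈) (minus-stack q v))

-- The mirror image of a sum, and `h`.

-- Edges of `u` reflect into the upper piece. Edges of `v` avoiding vertex 1 reflect into the part
-- covered by `lower`; those at vertex 1, which is shared with `u`, reflect to edges at the last
-- vertex, covered by `last`.
stack-mirror : ∀ u v {C} → Stack (mirror v) (mirror u) C → mirror (u ⊕ᵗ v) ≈ᵗ C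
stack-mirror (m , U) (n , V) {c , C} s =
  ⊆⇒≈ size≡ (mirror-⊆ (⟨plus⟩ U V) (Edge↑ C) λ x → go (to⇔ (plus-edge U V) x))
  where
  open Stack s
  size≡ : m + n ≡ c
  size≡ = trans (+-comm m n) (sym size)
  reflect-first : ∀ {i} → i ≤ 2 + m → n + reflect m i ≡ reflect (m + n) i
  reflect-first {i} i≤ = begin
    n + (m + 3 ∸ i)  ≡⟨ +-∸-assoc n (≤-n+3 i≤) ⟨
    n + (m + 3) ∸ i  ≡⟨ cong (_∸ i) (+-assoc n m 3) ⟨
    n + m + 3 ∸ i    ≡⟨ cong (λ k → k + 3 ∸ i) (+-comm n m) ⟩
    m + n + 3 ∸ i    ∎
    where open ≡-Reasoning
  reflect-second : ∀ {i} → 2 ≤ i → reflect n i ≡ reflect (m + n) (glue m i)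
  reflect-second {i} 2≤i = begin
    n + 3 ∸ i                ≡⟨ [m+n]∸[m+o]≡n∸o m (n + 3) i ⟨
    m + (n + 3) ∸ (m + i)    ≡⟨ cong (_∸ (m + i)) (+-assoc m n 3) ⟨
    m + n + 3 ∸ (m + i)      ≡⟨ cong (m + n + 3 ∸_) (glue-≥2 m 2≤i) ⟨
    m + n + 3 ∸ glue m i     ∎
    where open ≡-Reasoning
  second : ∀ {i j} → Edge↑ V i j →
           Edge↑ C (reflect (m + n) (glue m j)) (reflect (m + n) (glue m i))
  second {0} ((() , _) , _)
  second {1} {j} x@((_ , 2≤j , _) , _) =
    subst₂ (Edge↑ C) (reflect-second 2≤j) (sym (trans (reflect-1 (m + n)) (cong (2 +_) size≡)))
      (last (subst (Edge↑ (⟨mirror⟩ V) (reflect n j)) (reflect-1 n) (mirror-edge⁺ V x)))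
  second {suc (suc i)} x@((_ , i<j , _) , _) =
    subst₂ (Edge↑ C) (reflect-second (≤-trans 2≤ (<⇒≤ i<j))) (reflect-second 2≤)
      (lower (mirror-edge⁺ V x) (≤-trans (∸-monoʳ-≤ (n + 3) 2≤) (≤-reflexive (reflect-2 n))))
    where
    2≤ : 2 ≤ suc (suc i)
    2≤ = s≤s (s≤s z≤n)
  go : ∀ {i j} → PlusEdge U V i j → Edge↑ C (reflect (m + n) j) (reflect (m + n) i)
  go (inj₁ x@(ch@(_ , _ , j≤) , _)) =
    subst₂ (Edge↑ C) (reflect-first j≤) (reflect-first (chord-≤ ch)) (upper (mirror-edge⁺ U x))
  go (inj₂ (_ , _ , x , refl , refl)) = second x

mirror-⊕ : ∀ u v → mirror (u ⊕ᵗ v) ≈ᵗ mirror v ⊖ mirror u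
mirror-⊕ u v = stack-mirror u v (minus-stack (form (mirror v)) (mirror u))

-- By induction, `h′ q ⊖ γ (h′ p)` becomes `mirror v ⊖ γ (mirror u)`; as `γ (mirror u)` is the
-- mirror image of `lamᵗ u`, this is `mirror-⊕` read backwards.
h′-mirror : ∀ {t} (p : Form t) → h′ p ≈ᵗ mirror t
h′-mirror {t} (empty t≈e) = ≈-symm (zeroᵗ (mirror t) (same-size t≈e))
h′-mirror (node {u} {v} p q t≈) =
  ≈-trns (⊖-cong (h′-mirror q)
           (≈-trns (⊕ᵗ-cong (h′-mirror p) ≈-ref) (≈-symm (mirror-lam u))))
  (≈-trns (≈-symm (mirror-⊕ (lamᵗ u) v)) (≈-symm (mirror-cong t≈)))

h-mirror : ∀ t → h t ≈ᵗ mirror t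
h-mirror t = h′-mirror (form t)

proposition3p1 : (n : ℕ) (T : Triangulation n) →
    let hT = Operations.h triangulations (n , T) in
    proj₁ hT ≡ n ×
    (∀ a b → Edge (proj₂ hT) a b ⇔
    (∃₂ λ i j → Edge T i j × a ≡ n + 3 ∸ i × b ≡ n + 3 ∸ j))
proposition3p1 n T = same-size hT≈ , λ a b → mk⇔ to from
  where
  hT≈ : h (n , T) ≈ᵗ mirror (n , T)
  hT≈ = h-mirror (n , T)
  Reflected : Rel ℕ 0ℓ
  Reflected a b = ∃₂ λ i j → Edge T i j × a ≡ reflect n i × b ≡ reflect n j
  to : ∀ {a b} → Edge (proj₂ (h (n , T))) a b → Reflected a b
  -- An edge read upwards in the mirror image comes from one read downwards in `T`, so `fwd` and
  -- `bwd` trade places.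
  to (fwd x) = mirror-⊆ T Reflected
    (λ y → _ , _ , bwd y , refl , refl) (edge-≈ hT≈ x)
  to (bwd x) = mirror-⊆ T (λ b a → Reflected a b)
    (λ y → _ , _ , fwd y , refl , refl) (edge-≈ hT≈ x)
  from : ∀ {a b} → Reflected a b → Edge (proj₂ (h (n , T))) a b
  from (_ , _ , fwd x , refl , refl) = bwd (edge-≈ (≈-symm hT≈) (mirror-edge⁺ T x))
  from (_ , _ , bwd x , refl , refl) = fwd (edge-≈ (≈-symm hT≈) (mirror-edge⁺ T x))
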